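{- Let $r>0$ be an integer and let $X=\{x_1,x_2,\dots,x_n\}$ be an order-type homogeneous set of points in $\mathbb{R}^d$. Then $$\left\lfloor\frac{n}{r}\right\rfloor - c(d,r) \le t(X,r)\leq \left\lfloor\frac{n}{r}\right\rfloor-\left\lfloor\frac{d}{2}\right\rfloor,$$ where $t(X,r)$ is the tolerance of $X$ and $c(d,r)$ is the number, defined in the context, that guarantees intersecting convex hulls for alternating partitions.
   Context: An ordered set $X=\{x_1,\dots,x_n\}\subset\mathbb{R}^d$ (ordered by the indices) is called order-type homogeneous if the orientation of any ordered subset of $X$ with $d+1$ elements is always the same; i.e. for all $i_1<\dots<i_{d+1}$ the determinant of the $(d+1)\times(d+1)$ matrix with columns $(1,x_{i_1}),\dots,(1,x_{i_{d+1}})$ has the same nonzero sign. For a finite set $X\subset\mathbb{R}^d$, the tolerance $t(X,r)$ is the maximum number of points such that there is a partition $A_1,\dots,A_r$ of $X$ with the property that $\bigcap_{i=1}^r\operatorname{conv}(A_i\setminus Y)\ne\emptyset$ for any $Y\subset X$ with at most $t(X,r)$ points. The alternating partition of an ordered set $X=\{x_1,\dots,x_n\}$ into $r$ sets $A_1,\dots,A_r$ is given by $A_i=\{x_j : j\equiv i \pmod r\}$. The number $c(d,r)$, depending only on $d$ and $r$, is such that for every order-type homogeneous set of $n\ge c(d,r)$ points in $\mathbb{R}^d$ the alternating partition $A_1,\dots,A_r$ satisfies $\bigcap_{i=1}^r \operatorname{conv}(A_i)\ne\emptyset$; such a number exists with $c(d,r)\le (d+1)(\lfloor d/2\rfloo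r+1)(r-1)+1$.
   Formalization: The upper bound is claimed only if d ≤ 3, or r ≥ 2 and n > d; otherwise it can fail: for r = 1, d ≥ 4, t(X,1) = n−1 > n−⌊d/2⌋, and three collinear points in R^4 with r = 2 have t = 0 > −1. Both bounds concern X for which the maximum t(X,r) exists. -}

module Defs where

open import Level using (Level; _⊔_; 0ℓ) renaming (suc to lsuc)
open import Algebra.Bundles using (CommutativeRing; Semiring)
open import Algebra.Apartness.Bundles using (HeytingCommutativeRing; HeytingField)
import Algebra.Definitions.RawSemiring as RawSemiringDefs
open import Data.Fin.Base as Fin using (Fin; toℕ; punchIn)
open import Data.Fin.Subset as Subset using (Subset; ∣_∣)
open import Data.Nat.Base as ℕ using (ℕ; zero; suc; NonZero)
open import Data.Nat.DivMod using (_mod_)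
open import Data.Product.Base using (_×_; ∃-syntax)
open import Data.Sum.Base using (_⊎_)
open import Data.Vec.Functional using (Vector; _∷_)
open import Data.Vec.Functional.Relation.Binary.Pointwise using (Pointwise)
open import Function.Definitions using (Injective)
open import Relation.Binary.Core using (Rel; _Preserves_⟶_)
open import Relation.Binary.PropositionalEquality.Core using (_≡_)
open import Relation.Binary.Structures using (IsStrictPartialOrder)
open import Relation.Nullary.Negation using (¬_)
open import Relation.Unary using (Pred; _∈_; _∉_)

-- The real numbers, presented axiomatically as a Cauchy-complete Archimedean
-- ordered field.  Classically such a field is unique up to isomorphism; the
-- axioms do not assume a decidable order, so they also hold of the
-- constructive Cauchy reals.
record RealNumbers c ℓ₁ ℓ₂ : Set (lsuc (c ⊔ ℓ₁ ⊔ ℓ₂)) where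
  infix 4 _<_ _≤_
  field
    heytingField : HeytingField c ℓ₁ ℓ₂

  open HeytingField heytingField public using (_#_; heytingCommutativeRing)
  open HeytingCommutativeRing heytingCommutativeRing public using (commutativeRing)
  open CommutativeRing commutativeRing public
  open RawSemiringDefs (Semiring.rawSemiring semiring) public using (sum; _^_) renaming (_×_ to _·_)

  field
    _<_                  : Rel Carrier ℓ₂
    isStrictPartialOrder : IsStrictPartialOrder _≈_ _<_
    <⇒#                  : ∀ {x y} → x < y → x # y
    #⇒<⊎>                : ∀ {x y} → x # y → (x < y) ⊎ (y < x)
    +-monoʳ-<            : ∀ z {x y} → x < y → z + x < z + y
    *-pos                : ∀ {x y} → 0# < x → 0# < y → 0# < x * y
    archimedean          : ∀ x → ∃[ n ] x < n · 1#

  _≤_ : Rel Carrier ℓ₂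
  x ≤ y = ¬ (y < x)

  -- ∣ x - y ∣ < ε
  Within : Carrier → Carrier → Carrier → Set ℓ₂
  Within ε x y = (x - y < ε) × (y - x < ε)

  field
    complete : ∀ (s : ℕ → Carrier) →
      (∀ ε → 0# < ε → ∃[ N ] ∀ m n → N ℕ.≤ m → N ℕ.≤ n → Within ε (s m) (s n)) →
      ∃[ l ] ∀ ε → 0# < ε → ∃[ N ] ∀ n → N ℕ.≤ n → Within ε (s n) l


module Geometry {c ℓ₁ ℓ₂} (ℝ : RealNumbers c ℓ₁ ℓ₂) where
  open RealNumbers ℝ

  Matrix : ℕ → Set c
  Matrix m = Fin m → Fin m → Carrier

  -- Laplace expansion along the first row.
  det : ∀ {m} → Matrix m → Carrier
  det {zero}  M = 1#
  det {suc m} M = sum λ j →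
    (- 1#) ^ toℕ j * (M Fin.zero j * det λ a b → M (Fin.suc a) (punchIn j b))

  Point : ℕ → Set c
  Point d = Vector Carrier d

  infix 4 _≋_
  _≋_ : ∀ {d} → Rel (Point d) ℓ₁
  _≋_ = Pointwise _≈_

  -- The determinant of the matrix whose b-th column is (1 , y b).
  orientation : ∀ {d} → Vector (Point d) (suc d) → Carrier
  orientation y = det λ a b → (1# ∷ y b) a

  -- An ordered set of n points is an injective family indexed by Fin n, so
  -- the point of index j : Fin n is the (toℕ j + 1)-st one.
  IsOrderedSet : ∀ {d n} → Vector (Point d) n → Set ℓ₁
  IsOrderedSet x = Injective _≡_ _≋_ x

  OrderTypeHomogeneous : ∀ {d n} → Vector (Point d) n → Set ℓ₂
  OrderTypeHomogeneous {d} {n} x =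
      (∀ (ι : Fin (suc d) → Fin n) → ι Preserves Fin._<_ ⟶ Fin._<_ →
         0# < orientation (λ a → x (ι a)))
    ⊎ (∀ (ι : Fin (suc d) → Fin n) → ι Preserves Fin._<_ ⟶ Fin._<_ →
         orientation (λ a → x (ι a)) < 0#)

  -- The convex hull of { x j ∣ j ∈ S }: convex combinations of the whole
  -- family whose weights vanish outside S.
  conv : ∀ {d n} → Vector (Point d) n → Pred (Fin n) 0ℓ → Pred (Point d) (c ⊔ ℓ₁ ⊔ ℓ₂)
  conv {n = n} x S p = ∃[ w ]
      (∀ (j : Fin n) → 0# ≤ w j)
    × (∀ j → j ∉ S → w j ≈ 0#)
    × (sum w ≈ 1#)
    × ((λ k → sum λ j → w j * x j k) ≋ p)

  -- A partition of the indices into r parts is given by its labelling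
  -- A : Fin n → Fin r.  Empty parts need no exclusion, as their convex hull
  -- is empty.
  Partition : ℕ → ℕ → Set
  Partition n r = Fin n → Fin r

  part∖ : ∀ {n r} → Partition n r → Subset n → Fin r → Pred (Fin n) 0ℓ
  part∖ A Y i j = (A j ≡ i) × (j Subset.∉ Y)

  HullsMeetWithout : ∀ {d n r} → Vector (Point d) n → Partition n r → Subset n →
                     Set (c ⊔ ℓ₁ ⊔ ℓ₂)
  HullsMeetWithout x A Y = ∃[ p ] ∀ i → p ∈ conv x (part∖ A Y i)

  Tolerates : ∀ {d n} → Vector (Point d) n → ℕ → ℕ → Set (c ⊔ ℓ₁ ⊔ ℓ₂)
  Tolerates {n = n} x r k = ∃[ A ] ∀ (Y : Subset n) → ∣ Y ∣ ℕ.≤ k →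
    HullsMeetWithout {r = r} x A Y

  -- t is the maximum in the definition of t(X,r).  There is no such t when no
  -- partition into r parts has intersecting convex hulls.
  IsTolerance : ∀ {d n} → Vector (Point d) n → ℕ → ℕ → Set (c ⊔ ℓ₁ ⊔ ℓ₂)
  IsTolerance x r t = Tolerates x r t × (∀ k → Tolerates x r k → k ℕ.≤ t)

  alternating : ∀ n r .{{_ : NonZero r}} → Partition n r
  alternating n r j = toℕ j mod r

  -- The property characterising c(d,r) = C.
  GuaranteesAlternating : ∀ d r .{{_ : NonZero r}} → ℕ → Set (c ⊔ ℓ₁ ⊔ ℓ₂)
  GuaranteesAlternating d r C = ∀ n (x : Vector (Point d) n) →
    IsOrderedSet x → OrderTypeHomogeneous x → C ℕ.≤ n →
    HullsMeetWithout x (alternating n r) Subset.⊥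

module Submission where

-- Lower bound: cut the indices into ⌊n/r⌋ blocks of r consecutive ones.  After
-- deleting ⌊n/r⌋ - c points, c blocks remain untouched, and their union is an
-- order-type homogeneous set of c r ≥ c points, alternatingly coloured.
--
-- Upper bound: some part has at most ⌊n/r⌋ points.  If t > ⌊n/r⌋ - ⌊d/2⌋, then
-- deleting t of them leaves a set S with 2 ∣S∣ ≤ d.  For d ≤ 3 it is empty, and so
-- is its hull.  For r ≥ 2 and n > d, conv S is disjoint from the hull of the
-- points outside S (neighbourliness).  To see this, put S inside
-- a set Z of d indices satisfying Gale's evenness condition: the affine
-- functional f(y) = det(y, z₁, …, z_d) vanishes on Z and has a constant strict
-- sign on all other points, since sorting the columns costs (-1)^rank.  Hence a
-- common point of the two hulls has all its weights on Z.  Exchanging one index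
-- of Z ∖ S for one outside Z yields a functional that isolates the weight of
-- that index, so the weights outside S vanish altogether, yet they sum to 1.

open import Defs

open import Algebra.Apartness.Bundles using (HeytingField)
import Algebra.Properties.CommutativeMonoid.Sum
import Algebra.Properties.Ring as RingProperties
import Algebra.Properties.Semiring.Sum as SemiringSum
import Algebra.Solver.CommutativeMonoid as CommutativeMonoidSolver
open import Data.Bool.Base using (Bool; if_then_else_)
open import Data.Fin.Base as Fin using (Fin; zero; suc; toℕ; inject₁; punchIn; lift; _↑ʳ_)
open import Data.Fin.Induction using (<-weakInduction)
open import Data.Fin.Properties using (_≟_; any?; toℕ-inject₁; toℕ-↑ʳ; toℕ-injective; toℕ-fromℕ<; <-cmp; <⇒≢)
open import Data.Fin.Subset as Subset using (Subset; ∣_∣; _⊆_; inside; outside)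
open import Data.Fin.Subset.Properties using (_∈?_; ∣⊥∣≡0; drop-there; out⊆; s⊆s; ∣p∣≤∣x∷p∣)
open import Data.Integer.Base as ℤ using (_⊖_)
import Data.Integer.Properties as ℤ
open import Data.Nat.Base as ℕ using (ℕ; zero; suc; NonZero; parity; ⌊_/2⌋; _/_; _%_; z≤n; s≤s; s≤s⁻¹)
open import Data.Nat.DivMod using (/-monoˡ-≤; [m+n]%n≡m%n; m*n/n≡m; m%n<n; m/n*n≤m)
import Data.Nat.Properties as ℕ
open import Data.Parity.Base using (Parity; 0ℙ; 1ℙ; _⁻¹)
open import Data.Parity.Properties using (⁻¹-selfInverse; suc-homo-⁻¹)
open import Data.Product.Base using (_×_; _,_; ∃-syntax; proj₁; proj₂)
open import Data.Sum.Base as Sum using (_⊎_; inj₁; inj₂; [_,_])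
import Data.Vec.Base as Vec
open import Data.Vec.Functional as Vector using (Vector; insertAt)
open import Function.Base using (_∘_; id)
open import Relation.Binary.Core using (_Preserves_⟶_)
open import Relation.Binary.Definitions using (tri<; tri≈; tri>)
open import Relation.Binary.PropositionalEquality as ≡ using (_≡_; _≢_; cong)
import Relation.Binary.Reasoning.Setoid as SetoidReasoning
open import Relation.Binary.Structures using (IsStrictPartialOrder)
open import Relation.Nullary.Decidable using (yes; no; does; decidable-stable)
open import Relation.Nullary.Negation using (¬_; contradiction)

module Combinatorics where
  open import Data.Nat.Base using (_+_; _*_; _∸_; _≤_; _<_)
  open Subset using (_∈_; _∉_; ⊥)
  open Vec using ([]; _∷_; _++_; splitAt; here; there)
  open ≡ using (refl; sym; trans; subst)
  open Algebra.Properties.CommutativeMonoid.Sum ℕ.+-0-commutativeMonoid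
    using (sum; ∑-distrib-+; sum-cong-≗; sum-replicate-zero)

  Increasing : ∀ {m n} → (Fin m → Fin n) → Set
  Increasing ι = ι Preserves Fin._<_ ⟶ Fin._<_

  suc-increasing : ∀ {m n} {ι : Fin m → Fin n} → Increasing ι → Increasing (suc ∘ ι)
  suc-increasing inc i<j = s≤s (inc i<j)

  cons-increasing : ∀ {m n} {ι : Fin (suc m) → Fin (suc n)} {κ : Fin m → Fin n} →
    ι zero ≡ zero → (∀ i → ι (suc i) ≡ suc (κ i)) → Increasing κ → Increasing ι
  cons-increasing eq₀ eq inc {zero}  {suc j} _ rewrite eq₀ | eq j = s≤s z≤n
  cons-increasing eq₀ eq inc {suc i} {suc j} (s≤s i<j) rewrite eq i | eq j = s≤s (inc i<j)

  cong-increasing : ∀ {m n} {ι κ : Fin m → Fin n} → (∀ i → ι i ≡ κ i) → Increasing κ → Increasing ι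
  cong-increasing eq inc {i} {j} i<j rewrite eq i | eq j = inc i<j

  elements : ∀ {n} (Z : Subset n) → Fin ∣ Z ∣ → Fin n
  elements (inside  ∷ Z) zero    = zero
  elements (inside  ∷ Z) (suc i) = suc (elements Z i)
  elements (outside ∷ Z) i       = suc (elements Z i)

  rank : ∀ {n} (Z : Subset n) → Fin n → Fin (suc ∣ Z ∣)
  rank (_       ∷ Z) zero    = zero
  rank (inside  ∷ Z) (suc j) = suc (rank Z j)
  rank (outside ∷ Z) (suc j) = rank Z j

  elements-surjective : ∀ {n} (Z : Subset n) {j} → j ∈ Z → ∃[ b ] elements Z b ≡ j
  elements-surjective (inside  ∷ Z) here = zero , refl
  elements-surjective (inside  ∷ Z) (there j∈Z) with elements-surjective Z j∈Z
  ... | b , eq = suc b , cong suc eq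
  elements-surjective (outside ∷ Z) (there j∈Z) with elements-surjective Z j∈Z
  ... | b , eq = b , cong suc eq

  elements-increasing : ∀ {n} (Z : Subset n) → Increasing (elements Z)
  elements-increasing (inside  ∷ Z) = cons-increasing refl (λ _ → refl) (elements-increasing Z)
  elements-increasing (outside ∷ Z) = suc-increasing (elements-increasing Z)

  insertAt-map : ∀ {a b} {A : Set a} {B : Set b} (f : A → B) {m} (xs : Vector A m) b v k →
    insertAt (f ∘ xs) b (f v) k ≡ f (insertAt xs b v k)
  insertAt-map f         xs zero    v zero    = refl
  insertAt-map f         xs zero    v (suc k) = refl
  insertAt-map f {suc m} xs (suc b) v zero    = refl
  insertAt-map f {suc m} xs (suc b) v (suc k) = insertAt-map f (xs ∘ suc) b v k

  insert-increasing : ∀ {n} (Z : Subset n) j → j ∉ Z →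
    Increasing (insertAt (elements Z) (rank Z j) j)
  insert-increasing (inside  ∷ Z) zero    j∉Z = contradiction here j∉Z
  insert-increasing (outside ∷ Z) zero    j∉Z =
    cons-increasing refl (λ _ → refl) (elements-increasing Z)
  insert-increasing (inside  ∷ Z) (suc j) j∉Z =
    cons-increasing refl (insertAt-map suc (elements Z) (rank Z j) j) (insert-increasing Z j (j∉Z ∘ there))
  insert-increasing (outside ∷ Z) (suc j) j∉Z =
    cong-increasing (insertAt-map suc (elements Z) (rank Z j) j)
      (suc-increasing (insert-increasing Z j (j∉Z ∘ there)))

  GaleEvenAt : ∀ {n} → Parity → Subset n → Set
  GaleEvenAt p Z = ∀ j → j ∉ Z → parity (toℕ (rank Z j)) ≡ p

  GaleEven : ∀ {n} → Subset n → Set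
  GaleEven Z = ∃[ p ] GaleEvenAt p Z

  galeEven-inside : ∀ {n} {Z : Subset n} → GaleEven Z → GaleEven (inside ∷ Z)
  galeEven-inside {Z = Z} (p , gale) = p ⁻¹ , λ where
    zero    j∉ → contradiction here j∉
    (suc j) j∉ → trans (sym (⁻¹-selfInverse (suc-homo-⁻¹ (toℕ (rank Z j)))))
      (cong _⁻¹ (gale j (j∉ ∘ there)))

  galeEven-inside⁻¹ : ∀ {n} {Z : Subset n} → GaleEven (inside ∷ Z) → GaleEven Z
  galeEven-inside⁻¹ {Z = Z} (p , gale) = p ⁻¹ , λ j j∉ →
    trans (sym (suc-homo-⁻¹ (toℕ (rank Z j)))) (cong _⁻¹ (gale (suc j) (j∉ ∘ drop-there)))

  galeEven-outside⁻¹ : ∀ {n} {Z : Subset n} → GaleEven (outside ∷ Z) → GaleEven Z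
  galeEven-outside⁻¹ (p , gale) = p , λ j j∉ → gale (suc j) (j∉ ∘ drop-there)

  -- Absorbing the smallest missing element shifts the rank of all others by one.
  extend : ∀ {n} (Z : Subset n) → ∣ Z ∣ < n →
    ∃[ Z′ ] Z ⊆ Z′ × ∣ Z′ ∣ ≡ suc ∣ Z ∣ × (GaleEven Z → GaleEven Z′)
  extend (outside ∷ Z) _ = inside ∷ Z , out⊆ id , refl , galeEven-inside ∘ galeEven-outside⁻¹
  extend (inside ∷ Z) (s≤s ∣Z∣<n) with extend Z ∣Z∣<n
  ... | Z′ , Z⊆Z′ , eq , gale =
    inside ∷ Z′ , s⊆s Z⊆Z′ , cong suc eq , galeEven-inside ∘ gale ∘ galeEven-inside⁻¹

  fill : ∀ {n} k (Z : Subset n) → ∣ Z ∣ + k ≤ n → GaleEven Z →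
    ∃[ Z′ ] Z ⊆ Z′ × ∣ Z′ ∣ ≡ ∣ Z ∣ + k × GaleEven Z′
  fill {n} zero    Z _ gale = Z , id , sym (ℕ.+-identityʳ ∣ Z ∣) , gale
  fill {n} (suc k) Z ≤n gale with extend Z (ℕ.≤-trans (s≤s (ℕ.m≤m+n ∣ Z ∣ k)) ≤n′)
    where ≤n′ = subst (_≤ n) (ℕ.+-suc ∣ Z ∣ k) ≤n
  ... | Z₁ , Z⊆Z₁ , eq₁ , gale₁
    with fill k Z₁ (subst (_≤ n) (trans (ℕ.+-suc ∣ Z ∣ k) (cong (_+ k) (sym eq₁))) ≤n) (gale₁ gale)
  ... | Z₂ , Z₁⊆Z₂ , eq₂ , gale₂ = Z₂ , Z₁⊆Z₂ ∘ Z⊆Z₁ ,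
    trans eq₂ (trans (cong (_+ k) eq₁) (sym (ℕ.+-suc ∣ Z ∣ k))) , gale₂

  galeCover : ∀ {n} (S : Subset n) → ∃[ Z ] S ⊆ Z × ∣ Z ∣ ≤ 2 * ∣ S ∣ × GaleEvenAt 0ℙ Z
  galeCover []            = [] , id , z≤n , λ ()
  galeCover (outside ∷ S) with galeCover S
  ... | Z , S⊆Z , le , gale = outside ∷ Z , s⊆s S⊆Z , le , λ where
    zero    _  → refl
    (suc j) j∉ → gale j (j∉ ∘ there)
  galeCover (inside ∷ []) = inside ∷ [] , id , s≤s z≤n , λ where
    zero j∉ → contradiction here j∉
  galeCover (inside ∷ s ∷ S) with galeCover S
  ... | Z , S⊆Z , le , gale = inside ∷ inside ∷ Z , ⊆Z , ≤2*∣S∣ , λ where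
      zero          j∉ → contradiction here j∉
      (suc zero)    j∉ → contradiction (there here) j∉
      (suc (suc j)) j∉ → gale j (j∉ ∘ there ∘ there)
    where
    ⊆Z : inside ∷ s ∷ S ⊆ inside ∷ inside ∷ Z
    ⊆Z here              = here
    ⊆Z (there here)      = there here
    ⊆Z (there (there x)) = there (there (S⊆Z x))
    ≤2*∣S∣ : suc (suc ∣ Z ∣) ≤ 2 * suc ∣ s ∷ S ∣
    ≤2*∣S∣ = ℕ.≤-trans (s≤s (s≤s (ℕ.≤-trans le (ℕ.*-monoʳ-≤ 2 (∣p∣≤∣x∷p∣ s S)))))
      (ℕ.≤-reflexive (sym (ℕ.*-suc 2 ∣ s ∷ S ∣)))

  galeCover-exact : ∀ {n d} (S : Subset n) → 2 * ∣ S ∣ ≤ d → d ≤ n →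
    ∃[ Z ] S ⊆ Z × ∣ Z ∣ ≡ d × GaleEven Z
  galeCover-exact {n} {d} S 2∣S∣≤d d≤n with galeCover S
  ... | Z , S⊆Z , le , gale with fill (d ∸ ∣ Z ∣) Z (subst (_≤ n) (sym eq) d≤n) (0ℙ , gale)
    where eq = ℕ.m+[n∸m]≡n (ℕ.≤-trans le 2∣S∣≤d)
  ... | Z′ , Z⊆Z′ , eq′ , gale′ =
    Z′ , Z⊆Z′ ∘ S⊆Z , trans eq′ (ℕ.m+[n∸m]≡n (ℕ.≤-trans le 2∣S∣≤d)) , gale′

  remove : ∀ {n} {Z : Subset n} {i} → i ∈ Z →
    ∃[ Z′ ] suc ∣ Z′ ∣ ≡ ∣ Z ∣ × i ∉ Z′ × (∀ {j} → j ∈ Z → j ≢ i → j ∈ Z′)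
  remove {Z = inside ∷ Z} here = outside ∷ Z , refl , (λ ()) , λ where
    here      j≢i → contradiction refl j≢i
    (there j∈) _  → there j∈
  remove {Z = s ∷ Z} (there i∈Z) with remove i∈Z
  ... | Z′ , eq , i∉Z′ , sub = s ∷ Z′ , size s , i∉Z′ ∘ drop-there , λ where
      here       _   → here
      (there j∈) j≢i → there (sub j∈ (j≢i ∘ cong suc))
    where
    size : ∀ s → suc ∣ s ∷ Z′ ∣ ≡ ∣ s ∷ Z ∣
    size inside  = cong suc eq
    size outside = eq

  exchange : ∀ {n} {Z : Subset n} {i} → i ∈ Z → ∣ Z ∣ < n →
    ∃[ Z′ ] ∣ Z′ ∣ ≡ ∣ Z ∣ × i ∉ Z′ × (∀ {j} → j ∈ Z → j ≢ i → j ∈ Z′)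
  exchange {Z = inside ∷ Z} here (s≤s ∣Z∣<n) with extend Z ∣Z∣<n
  ... | Z′ , Z⊆Z′ , eq , _ = outside ∷ Z′ , eq , (λ ()) , λ where
    here       j≢i → contradiction refl j≢i
    (there j∈) _   → there (Z⊆Z′ j∈)
  exchange {Z = inside ∷ Z} (there i∈Z) (s≤s ∣Z∣<n) with exchange i∈Z ∣Z∣<n
  ... | Z′ , eq , i∉Z′ , sub = inside ∷ Z′ , cong suc eq , i∉Z′ ∘ drop-there , λ where
    here       _   → here
    (there j∈) j≢i → there (sub j∈ (j≢i ∘ cong suc))
  exchange {Z = outside ∷ Z} (there i∈Z) _ with remove i∈Z
  ... | Z′ , eq , i∉Z′ , sub = inside ∷ Z′ , eq , i∉Z′ ∘ drop-there , λ where
    (there j∈) j≢i → there (sub j∈ (j≢i ∘ cong suc))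

  deleteUpTo : ∀ {n} (P : Subset n) t →
    ∃[ Y ] ∃[ S ] ∣ Y ∣ ≤ t × ∣ S ∣ ≤ ∣ P ∣ ∸ t × S ⊆ P × (∀ {j} → j ∈ P → j ∉ Y → j ∈ S)
  deleteUpTo {n} P zero = ⊥ , P , ℕ.≤-reflexive (∣⊥∣≡0 n) , ℕ.≤-refl , id , λ j∈P _ → j∈P
  deleteUpTo [] (suc t) = [] , [] , z≤n , z≤n , id , λ j∈P _ → j∈P
  deleteUpTo (outside ∷ P) (suc t) with deleteUpTo P (suc t)
  ... | Y , S , ∣Y∣≤ , ∣S∣≤ , S⊆P , rest = outside ∷ Y , outside ∷ S , ∣Y∣≤ , ∣S∣≤ , s⊆s S⊆P , λ where
    (there j∈P) j∉Y → there (rest j∈P (j∉Y ∘ there))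
  deleteUpTo (inside ∷ P) (suc t) with deleteUpTo P t
  ... | Y , S , ∣Y∣≤ , ∣S∣≤ , S⊆P , rest = inside ∷ Y , outside ∷ S , s≤s ∣Y∣≤ , ∣S∣≤ , out⊆ S⊆P , λ where
    here        j∉Y → contradiction here j∉Y
    (there j∈P) j∉Y → there (rest j∈P (j∉Y ∘ there))

  fibre : ∀ {n r} → (Fin n → Fin r) → Fin r → Subset n
  fibre {zero}  A i = []
  fibre {suc n} A i = does (A zero ≟ i) ∷ fibre (A ∘ suc) i

  ∈-fibre⁺ : ∀ {n r} (A : Fin n → Fin r) {i} j → A j ≡ i → j ∈ fibre A i
  ∈-fibre⁺ A {i} zero eq with A zero ≟ i
  ... | yes _  = here
  ... | no  ≢i = contradiction eq ≢i
  ∈-fibre⁺ A (suc j) eq = there (∈-fibre⁺ (A ∘ suc) j eq)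

  ∈-fibre⁻ : ∀ {n r} (A : Fin n → Fin r) {i} j → j ∈ fibre A i → A j ≡ i
  ∈-fibre⁻ A {i} zero j∈ with A zero ≟ i | j∈
  ... | yes eq | _ = eq
  ∈-fibre⁻ A (suc j) (there j∈) = ∈-fibre⁻ (A ∘ suc) j j∈

  indicator : Bool → ℕ
  indicator b = if b then 1 else 0

  sum-indicator : ∀ {r} (a : Fin r) → sum (λ i → indicator (does (a ≟ i))) ≡ 1
  sum-indicator {suc r} zero    = cong suc (sum-replicate-zero r)
  sum-indicator {suc r} (suc a) = sum-indicator a

  sum-∣fibre∣ : ∀ {n r} (A : Fin n → Fin r) → sum (λ i → ∣ fibre A i ∣) ≡ n
  sum-∣fibre∣ {zero}  {r} A = sum-replicate-zero r
  sum-∣fibre∣ {suc n} {r} A = begin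
    sum (λ i → ∣ fibre A i ∣)
      ≡⟨ sum-cong-≗ (λ i → ∣∷∣ (does (A zero ≟ i)) (fibre (A ∘ suc) i)) ⟩
    sum (λ i → indicator (does (A zero ≟ i)) + ∣ fibre (A ∘ suc) i ∣)
      ≡⟨ ∑-distrib-+ {r} _ _ ⟩
    sum (λ i → indicator (does (A zero ≟ i))) + sum (λ i → ∣ fibre (A ∘ suc) i ∣)
      ≡⟨ ≡.cong₂ _+_ (sum-indicator (A zero)) (sum-∣fibre∣ (A ∘ suc)) ⟩
    suc n ∎
    where
    open ≡.≡-Reasoning
    ∣∷∣ : ∀ s (p : Subset n) → ∣ s ∷ p ∣ ≡ indicator s + ∣ p ∣
    ∣∷∣ inside  p = refl
    ∣∷∣ outside p = refl

  sum-lowerBound : ∀ {r q} (f : Fin r → ℕ) → (∀ i → q ≤ f i) → r * q ≤ sum f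
  sum-lowerBound {zero}  f q≤f = z≤n
  sum-lowerBound {suc r} f q≤f = ℕ.+-mono-≤ (q≤f zero) (sum-lowerBound (f ∘ suc) (q≤f ∘ suc))

  smallFibre : ∀ {n r} .{{_ : NonZero r}} (A : Fin n → Fin r) → ∃[ i ] ∣ fibre A i ∣ ≤ n / r
  smallFibre {n} {r} A with any? (λ i → ∣ fibre A i ∣ ℕ.≤? n / r)
  ... | yes small = small
  ... | no ¬small = contradiction
    (subst (_≤ n / r) (m*n/n≡m (suc (n / r)) r) (/-monoˡ-≤ r (begin
      suc (n / r) * r             ≡⟨ ℕ.*-comm (suc (n / r)) r ⟩
      r * suc (n / r)             ≤⟨ sum-lowerBound _ (λ i → ℕ.≰⇒> (λ le → ¬small (i , le))) ⟩
      sum (λ i → ∣ fibre A i ∣)   ≡⟨ sum-∣fibre∣ A ⟩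
      n                           ∎)))
    (ℕ.<-irrefl refl)
    where open ℕ.≤-Reasoning

  ∣++∣ : ∀ {m n} (p : Subset m) (q : Subset n) → ∣ p ++ q ∣ ≡ ∣ p ∣ + ∣ q ∣
  ∣++∣ []            q = refl
  ∣++∣ (inside  ∷ p) q = cong suc (∣++∣ p q)
  ∣++∣ (outside ∷ p) q = ∣++∣ p q

  lift-increasing : ∀ k {m n} {f : Fin m → Fin n} → Increasing f → Increasing (lift k f)
  lift-increasing zero    inc = inc
  lift-increasing (suc k) inc = cons-increasing refl (λ _ → refl) (lift-increasing k inc)

  raise-increasing : ∀ k {m n} {f : Fin m → Fin n} → Increasing f → Increasing ((k ↑ʳ_) ∘ f)
  raise-increasing zero    inc = inc
  raise-increasing (suc k) inc = suc-increasing (raise-increasing k inc)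

  toℕ-lift : ∀ k {m n} (f : Fin m → Fin n) j →
    toℕ (lift k f j) ≡ toℕ j ⊎ ∃[ i ] toℕ j ≡ k + toℕ i × toℕ (lift k f j) ≡ k + toℕ (f i)
  toℕ-lift zero    f j    = inj₂ (j , refl , refl)
  toℕ-lift (suc k) f zero = inj₁ refl
  toℕ-lift (suc k) f (suc j) with toℕ-lift k f j
  ... | inj₁ eq             = inj₁ (cong suc eq)
  ... | inj₂ (i , eq , eq′) = inj₂ (i , cong suc eq , cong suc eq′)

  lift-∉ : ∀ {k m n} (p : Subset k) {q : Subset n} {f : Fin m → Fin n} →
    ∣ p ∣ ≡ 0 → (∀ i → f i ∉ q) → ∀ j → lift k f j ∉ p ++ q
  lift-∉ []            _  f∉q j    j∈         = f∉q j j∈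
  lift-∉ (outside ∷ p) eq f∉q (suc j) (there j∈) = lift-∉ p eq f∉q j j∈

  raise-∉ : ∀ {k n} (p : Subset k) {q : Subset n} {i} → i ∉ q → k ↑ʳ i ∉ p ++ q
  raise-∉ []      i∉q i∈         = i∉q i∈
  raise-∉ (_ ∷ p) i∉q (there i∈) = raise-∉ p i∉q i∈

  Avoiding : ∀ {n} → ℕ → (r : ℕ) .{{_ : NonZero r}} → Subset n → Set
  Avoiding {n} m r Y = ∃[ e ] Increasing {m} {n} e ×
    (∀ j → toℕ (e j) % r ≡ toℕ j % r) × (∀ j → e j ∉ Y)

  -- Cut the indices into blocks of r consecutive ones.  At most ∣ Y ∣ of the
  -- blocks meet Y, and the others, concatenated, keep the residues modulo r.
  avoiding : ∀ {n} r .{{_ : NonZero r}} a c (Y : Subset n) →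
    a * r ≤ n → ∣ Y ∣ + c ≤ a → Avoiding (c * r) r Y
  avoiding r a zero Y _ _ = (λ ()) , (λ {}) , (λ ()) , (λ ())
  avoiding r zero (suc c) Y _ le = contradiction (ℕ.≤-trans (ℕ.m≤n+m (suc c) ∣ Y ∣) le) λ ()
  avoiding r (suc a) (suc c) Y le ∣Y∣+c≤a
    with n′ , refl ← ℕ.m≤n⇒∃[o]m+o≡n (ℕ.≤-trans (ℕ.m≤m+n r (a * r)) le)
    with Y₁ , Y₂ , refl ← splitAt r Y
    with ∣ Y₁ ∣ in ∣Y₁∣ | subst (λ k → k + suc c ≤ suc a) (∣++∣ Y₁ Y₂) ∣Y∣+c≤a
  ... | zero | bound
    with avoiding r a c Y₂ (ℕ.+-cancelˡ-≤ r _ _ le)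
           (s≤s⁻¹ (subst (_≤ suc a) (ℕ.+-suc ∣ Y₂ ∣ c) bound))
  ...   | e , inc , mod , e∉ = lift r e , lift-increasing r inc , mod′ , lift-∉ Y₁ ∣Y₁∣ e∉
    where
    mod′ : ∀ j → toℕ (lift r e j) % r ≡ toℕ j % r
    mod′ j with toℕ-lift r e j
    ... | inj₁ eq = cong (_% r) eq
    ... | inj₂ (i , eq , eq′) = begin
      toℕ (lift r e j) % r ≡⟨ cong (_% r) eq′ ⟩
      (r + toℕ (e i)) % r  ≡⟨ [r+m]%r≡m%r (toℕ (e i)) ⟩
      toℕ (e i) % r        ≡⟨ mod i ⟩
      toℕ i % r            ≡⟨ [r+m]%r≡m%r (toℕ i) ⟨
      (r + toℕ i) % r      ≡⟨ cong (_% r) eq ⟨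
      toℕ j % r            ∎
      where
      open ≡.≡-Reasoning
      [r+m]%r≡m%r : ∀ m → (r + m) % r ≡ m % r
      [r+m]%r≡m%r m = trans (cong (_% r) (ℕ.+-comm r m)) ([m+n]%n≡m%n m r)
  avoiding r (suc a) (suc c) Y le ∣Y∣+c≤a | suc k | bound
    with avoiding r a (suc c) Y₂ (ℕ.+-cancelˡ-≤ r _ _ le)
           (ℕ.≤-trans (ℕ.+-monoˡ-≤ (suc c) (ℕ.m≤n+m ∣ Y₂ ∣ k)) (s≤s⁻¹ bound))
  ... | e , inc , mod , e∉ = (r ↑ʳ_) ∘ e , raise-increasing r inc ,
    (λ j → trans (trans (cong (_% r) (trans (toℕ-↑ʳ r (e j)) (ℕ.+-comm r _))) ([m+n]%n≡m%n _ r)) (mod j)) ,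
    raise-∉ Y₁ ∘ e∉

  increasing⇒injective : ∀ {m n} {f : Fin m → Fin n} → Increasing f → ∀ {i j} → f i ≡ f j → i ≡ j
  increasing⇒injective inc {i} {j} eq with <-cmp i j
  ... | tri< i<j _ _ = contradiction eq (<⇒≢ (inc i<j))
  ... | tri≈ _ i≡j _ = i≡j
  ... | tri> _ _ j<i = contradiction (sym eq) (<⇒≢ (inc j<i))

swapAdjacent : ∀ {m} → Fin m → Fin (suc m) → Fin (suc m)
swapAdjacent zero    zero          = suc zero
swapAdjacent zero    (suc zero)    = zero
swapAdjacent zero    (suc (suc j)) = suc (suc j)
swapAdjacent (suc c) zero          = zero
swapAdjacent (suc c) (suc j)       = suc (swapAdjacent c j)

data SwapView : ∀ {m} → Fin m → Fin (suc m) → Set where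
  moved : ∀ {m} {c : Fin m} {j} →
    toℕ (swapAdjacent c j) ≡ suc (toℕ j) ⊎ toℕ j ≡ suc (toℕ (swapAdjacent c j)) →
    (∀ b → swapAdjacent c (punchIn j b) ≡ punchIn (swapAdjacent c j) b) →
    SwapView c j
  fixed : ∀ {m} {c : Fin (suc m)} {j} (c′ : Fin m) →
    swapAdjacent c j ≡ j →
    (∀ b → swapAdjacent c (punchIn j b) ≡ punchIn j (swapAdjacent c′ b)) →
    SwapView c j

swapView : ∀ {m} (c : Fin m) j → SwapView c j
swapView zero zero = moved (inj₁ ≡.refl) λ { zero → ≡.refl ; (suc b) → ≡.refl }
swapView zero (suc zero) = moved (inj₂ ≡.refl) λ { zero → ≡.refl ; (suc b) → ≡.refl }
swapView {suc (suc m)} zero (suc (suc j)) =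
  fixed zero ≡.refl λ { zero → ≡.refl ; (suc zero) → ≡.refl ; (suc (suc b)) → ≡.refl }
swapView {suc (suc m)} (suc c) zero = fixed c ≡.refl λ b → ≡.refl
swapView (suc c) (suc j) with swapView c j
... | moved adj eq = moved (Sum.map (cong suc) (cong suc) adj)
  λ { zero → ≡.refl ; (suc b) → cong suc (eq b) }
... | fixed c′ fix eq = fixed (suc c′) (cong suc fix)
  λ { zero → ≡.refl ; (suc b) → cong suc (eq b) }

insertAt-suc : ∀ {a} {A : Set a} {m} (xs : Vector A m) (b : Fin m) v k →
  insertAt xs (suc b) v k ≡ insertAt xs (inject₁ b) v (swapAdjacent b k)
insertAt-suc xs zero    v zero          = ≡.refl
insertAt-suc xs zero    v (suc zero)    = ≡.refl
insertAt-suc xs zero    v (suc (suc k)) = ≡.refl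
insertAt-suc xs (suc b) v zero          = ≡.refl
insertAt-suc xs (suc b) v (suc k)       = insertAt-suc (xs ∘ suc) b v k

insertAt-duplicate : ∀ {a} {A : Set a} {m} (xs : Vector A m) (b : Fin m) k →
  insertAt xs (suc b) (xs b) k ≡ insertAt xs (inject₁ b) (xs b) k
insertAt-duplicate xs zero    zero          = ≡.refl
insertAt-duplicate xs zero    (suc zero)    = ≡.refl
insertAt-duplicate xs zero    (suc (suc k)) = ≡.refl
insertAt-duplicate xs (suc b) zero          = ≡.refl
insertAt-duplicate xs (suc b) (suc k)       = insertAt-duplicate (xs ∘ suc) b k

module OrderedField {a ℓ₁ ℓ₂} (ℝ : RealNumbers a ℓ₁ ℓ₂) where
  open RealNumbers ℝ hiding (zero)
  open RingProperties ring
  open SemiringSum semiring using (sum-cong-≋; sum-replicate-zero)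
  open IsStrictPartialOrder isStrictPartialOrder public
    using (<-resp-≈) renaming (irrefl to <-irrefl; trans to <-trans)
  private module HF = HeytingField heytingField

  <-respʳ : ∀ {x y z} → y ≈ z → x < y → x < z
  <-respʳ = proj₁ <-resp-≈

  <-respˡ : ∀ {x y z} → y ≈ z → y < x → z < x
  <-respˡ = proj₂ <-resp-≈

  ≤-antisym : ∀ {x y} → x ≤ y → y ≤ x → x ≈ y
  ≤-antisym {x} {y} y≮x x≮y = proj₁ (HF.tight x y) ([ x≮y , y≮x ] ∘ #⇒<⊎>)

  1≉0 : ¬ (1# ≈ 0#)
  1≉0 1≈0 = HF.#-irrefl 1≈0 (HF.invertible⇒# (1# , eq₁ , eq₂))
    where
    1-0≈1 : 1# - 0# ≈ 1#
    1-0≈1 = trans (+-congˡ -0#≈0#) (+-identityʳ 1#)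
    eq₁ : 1# * (1# - 0#) ≈ 1#
    eq₁ = trans (*-identityˡ _) 1-0≈1
    eq₂ : (1# - 0#) * 1# ≈ 1#
    eq₂ = trans (*-identityʳ _) 1-0≈1

  neg⇒pos : ∀ {x} → x < 0# → 0# < - x
  neg⇒pos {x} x<0 = <-respʳ (+-identityʳ _) (<-respˡ (-‿inverseˡ x) (+-monoʳ-< (- x) x<0))

  pos⇒neg : ∀ {x} → 0# < x → - x < 0#
  pos⇒neg {x} 0<x = <-respʳ (-‿inverseˡ x) (<-respˡ (+-identityʳ _) (+-monoʳ-< (- x) 0<x))

  <-asym : ∀ {x y} → x < y → ¬ (y < x)
  <-asym x<y y<x = <-irrefl refl (<-trans x<y y<x)

  ≤-resp : ∀ {x y} → x ≈ y → 0# ≤ x → 0# ≤ y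
  ≤-resp x≈y 0≤x y<0 = 0≤x (<-respˡ (sym x≈y) y<0)

  ≤-refl : ∀ {x} → x ≤ x
  ≤-refl = <-irrefl refl

  x+x≈0⇒x≈0 : ∀ {x} → x + x ≈ 0# → x ≈ 0#
  x+x≈0⇒x≈0 {x} x+x≈0 = ≤-antisym
    (λ 0<x → <-asym 0<x (<-respˡ (sym x≈-x) (pos⇒neg 0<x)))
    (λ x<0 → <-asym x<0 (<-respʳ (sym x≈-x) (neg⇒pos x<0)))
    where
    x≈-x : x ≈ - x
    x≈-x = +-inverseˡ-unique _ _ x+x≈0

  +-nonNeg : ∀ {x y} → 0# ≤ x → 0# ≤ y → 0# ≤ x + y
  +-nonNeg {x} {y} 0≤x 0≤y x+y<0 with HF.#-cotrans (<⇒# x+y<0) x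
  ... | inj₂ x#0 with #⇒<⊎> x#0
  ...   | inj₁ x<0 = 0≤x x<0
  ...   | inj₂ 0<x = 0≤y (<-trans (<-respˡ (trans (+-comm y 0#) (+-identityˡ y)) (+-monoʳ-< y 0<x))
                                  (<-respˡ (+-comm x y) x+y<0))
  +-nonNeg {x} {y} 0≤x 0≤y x+y<0 | inj₁ x+y#x with #⇒<⊎> x+y#x
  ...   | inj₁ x+y<x = 0≤y (<-respʳ (-‿inverseˡ x) (<-respˡ cancel (+-monoʳ-< (- x) x+y<x)))
    where
    cancel : - x + (x + y) ≈ y
    cancel = trans (sym (+-assoc _ _ _)) (trans (+-congʳ (-‿inverseˡ x)) (+-identityˡ y))
  ...   | inj₂ x<x+y = 0≤x (<-trans x<x+y x+y<0)

  x+y≈0⇒x≈0 : ∀ {x y} → 0# ≤ x → 0# ≤ y → x + y ≈ 0# → x ≈ 0#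
  x+y≈0⇒x≈0 {x} {y} 0≤x 0≤y x+y≈0 = ≤-antisym
    (λ 0<x → 0≤y (<-respˡ (sym (+-inverseʳ-unique x y x+y≈0)) (pos⇒neg 0<x))) 0≤x

  *-nonNeg-pos : ∀ {x y} → 0# ≤ x → 0# < y → 0# ≤ x * y
  *-nonNeg-pos {x} {y} 0≤x 0<y xy<0 =
    <-irrefl (trans (*-congʳ x≈0) (zeroˡ y)) xy<0
    where
    x≈0 : x ≈ 0#
    x≈0 = ≤-antisym (λ 0<x → <-asym xy<0 (*-pos 0<x 0<y)) 0≤x

  x*y≈0⇒x≈0 : ∀ {x y} → 0# ≤ x → 0# < y → x * y ≈ 0# → x ≈ 0#
  x*y≈0⇒x≈0 0≤x 0<y xy≈0 = ≤-antisym
    (λ 0<x → <-irrefl (sym xy≈0) (*-pos 0<x 0<y)) 0≤x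

  sum-zero : ∀ {n} {f : Vector Carrier n} → (∀ j → f j ≈ 0#) → sum f ≈ 0#
  sum-zero {n} f≈0 = trans (sum-cong-≋ f≈0) (sum-replicate-zero n)

  sum-nonNeg : ∀ {n} {f : Vector Carrier n} → (∀ j → 0# ≤ f j) → 0# ≤ sum f
  sum-nonNeg {zero}  0≤f = ≤-refl
  sum-nonNeg {suc n} 0≤f = +-nonNeg (0≤f zero) (sum-nonNeg (0≤f ∘ suc))

  sum≈0⇒≈0 : ∀ {n} {f : Vector Carrier n} → (∀ j → 0# ≤ f j) → sum f ≈ 0# → ∀ j → f j ≈ 0#
  sum≈0⇒≈0 0≤f sum≈0 zero    = x+y≈0⇒x≈0 (0≤f zero) (sum-nonNeg (0≤f ∘ suc)) sum≈0
  sum≈0⇒≈0 0≤f sum≈0 (suc j) = sum≈0⇒≈0 (0≤f ∘ suc)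
    (x+y≈0⇒x≈0 (sum-nonNeg (0≤f ∘ suc)) (0≤f zero) (trans (+-comm _ _) sum≈0)) j

module Determinant {a ℓ₁ ℓ₂} (ℝ : RealNumbers a ℓ₁ ℓ₂) where
  open RealNumbers ℝ hiding (zero)
  open Geometry ℝ
  open Vector using (_∷_)
  open OrderedField ℝ
  open RingProperties ring
  open SemiringSum semiring using (sum-cong-≋; ∑-comm; *-distribˡ-sum; *-distribʳ-sum)
  open CommutativeMonoidSolver *-commutativeMonoid using (solve; _⊕_; _⊜_)
  open SetoidReasoning setoid

  minor : ∀ {m} → Matrix (suc m) → Fin (suc m) → Matrix m
  minor M j a b = M (suc a) (punchIn j b)

  laplaceTerm : ∀ {m} → Matrix (suc m) → Fin (suc m) → Carrier
  laplaceTerm M j = (- 1#) ^ toℕ j * (M zero j * det (minor M j))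

  det-cong : ∀ {m} {M N : Matrix m} → (∀ a b → M a b ≈ N a b) → det M ≈ det N
  det-cong {zero}  M≈N = refl
  det-cong {suc m} M≈N = sum-cong-≋ λ j →
    *-congˡ {(- 1#) ^ toℕ j} (*-cong (M≈N zero j) (det-cong λ a b → M≈N (suc a) (punchIn j b)))

  sum-neg : ∀ {n} (f : Vector Carrier n) → sum (λ j → - f j) ≈ - sum f
  sum-neg {zero}  f = sym -0#≈0#
  sum-neg {suc n} f = trans (+-congˡ (sum-neg (f ∘ suc))) (-‿+-comm _ _)

  sum-swapAdjacent : ∀ {m} (c : Fin m) (f : Vector Carrier (suc m)) →
    sum (f ∘ swapAdjacent c) ≈ sum f
  sum-swapAdjacent zero f =
    trans (sym (+-assoc _ _ _)) (trans (+-congʳ (+-comm _ _)) (+-assoc _ _ _))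
  sum-swapAdjacent (suc c) f = +-congˡ (sum-swapAdjacent c (f ∘ suc))

  -1*x*y≈-xy : ∀ x y → (- 1# * x) * y ≈ - (x * y)
  -1*x*y≈-xy x y = trans (*-congʳ (-1*x≈-x x)) (sym (-‿distribˡ-* x y))

  sign-adjacent : ∀ {m n} → m ≡ suc n ⊎ n ≡ suc m → (- 1#) ^ n ≈ - ((- 1#) ^ m)
  sign-adjacent (inj₂ ≡.refl) = -1*x≈-x _
  sign-adjacent (inj₁ ≡.refl) = sym (trans (-‿cong (-1*x≈-x _)) (-‿involutive _))

  det-swapAdjacent : ∀ {m} (c : Fin m) (M : Matrix (suc m)) →
    det (λ a b → M a (swapAdjacent c b)) ≈ - det M
  det-swapAdjacent c M = begin
    sum (laplaceTerm M′)                            ≈⟨ sum-cong-≋ term-swap ⟩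
    sum (λ j → - laplaceTerm M (swapAdjacent c j))  ≈⟨ sum-neg (laplaceTerm M ∘ swapAdjacent c) ⟩
    - sum (laplaceTerm M ∘ swapAdjacent c)          ≈⟨ -‿cong (sum-swapAdjacent c (laplaceTerm M)) ⟩
    - sum (laplaceTerm M)                           ∎
    where
    M′ = λ a b → M a (swapAdjacent c b)

    term-swap : ∀ j → laplaceTerm M′ j ≈ - laplaceTerm M (swapAdjacent c j)
    term-swap j with swapView c j
    ... | moved adj eq = begin
      laplaceTerm M′ j
        ≈⟨ *-cong (sign-adjacent adj)
             (*-congˡ {M zero (swapAdjacent c j)} (det-cong λ a b → reflexive (cong (M (suc a)) (eq b)))) ⟩
      - ((- 1#) ^ toℕ (swapAdjacent c j)) * (M zero (swapAdjacent c j) * det (minor M (swapAdjacent c j)))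
        ≈⟨ sym (-‿distribˡ-* _ _) ⟩
      - laplaceTerm M (swapAdjacent c j) ∎
    ... | fixed c′ fix eq rewrite fix = begin
      (- 1#) ^ toℕ j * (M zero j * det (minor M′ j))
        ≈⟨ *-congˡ {(- 1#) ^ toℕ j} (*-congˡ {M zero j} (trans (det-cong λ a b → reflexive (cong (M (suc a)) (eq b)))
             (det-swapAdjacent c′ (minor M j)))) ⟩
      (- 1#) ^ toℕ j * (M zero j * - det (minor M j))
        ≈⟨ *-congˡ {(- 1#) ^ toℕ j} (sym (-‿distribʳ-* _ _)) ⟩
      (- 1#) ^ toℕ j * - (M zero j * det (minor M j))
        ≈⟨ sym (-‿distribʳ-* _ _) ⟩
      - laplaceTerm M j ∎

  laplaceTerm-dependent : ∀ {n m} (v : Vector Carrier n) (u : Fin n → Vector Carrier (suc m))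
    (N : Fin (suc m) → Vector Carrier m) →
    (∀ a → sum (λ j → v j * u j a) ≈ 0#) →
    ∀ k → sum (λ j → v j * laplaceTerm (λ a → u j a ∷ N a) k) ≈ 0#
  det-firstColumn-dependent : ∀ {n m} (v : Vector Carrier n) (u : Fin n → Vector Carrier (suc m))
    (N : Fin (suc m) → Vector Carrier m) →
    (∀ a → sum (λ j → v j * u j a) ≈ 0#) →
    sum (λ j → v j * det (λ a → u j a ∷ N a)) ≈ 0#

  det-firstColumn-dependent v u N dep = begin
    sum (λ j → v j * det (M j))
      ≈⟨ sum-cong-≋ (λ j → *-distribˡ-sum (v j) (laplaceTerm (M j))) ⟩
    sum (λ j → sum (λ k → v j * laplaceTerm (M j) k))
      ≈⟨ ∑-comm (λ j k → v j * laplaceTerm (M j) k) ⟩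
    sum (λ k → sum (λ j → v j * laplaceTerm (M j) k))
      ≈⟨ sum-zero (laplaceTerm-dependent v u N dep) ⟩
    0# ∎
    where
    M = λ j a → u j a ∷ N a

  laplaceTerm-dependent {n} v u N dep zero = begin
    sum (λ j → v j * (1# * (u j zero * D)))
      ≈⟨ sum-cong-≋ {n} (λ j → trans (*-congˡ (*-identityˡ _)) (sym (*-assoc _ _ _))) ⟩
    sum (λ j → (v j * u j zero) * D)
      ≈⟨ sym (*-distribʳ-sum D (λ j → v j * u j zero)) ⟩
    sum (λ j → v j * u j zero) * D
      ≈⟨ trans (*-congʳ (dep zero)) (zeroˡ D) ⟩
    0# ∎
    where D = det (λ a b → N (suc a) b)
  laplaceTerm-dependent {n} {suc m} v u N dep (suc k) = begin
    sum (λ j → v j * (s * (e * det (minor (λ a → u j a ∷ N a) (suc k)))))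
      ≈⟨ sum-cong-≋ (λ j → trans
           (*-congˡ (*-congˡ (*-congˡ (minor-split j))))
           (solve 4 (λ v s e d → v ⊕ (s ⊕ (e ⊕ d)) ⊜ (s ⊕ e) ⊕ (v ⊕ d)) refl (v j) s e (D j))) ⟩
    sum (λ j → (s * e) * (v j * D j))
      ≈⟨ sym (*-distribˡ-sum (s * e) (λ j → v j * D j)) ⟩
    (s * e) * sum (λ j → v j * D j)
      ≈⟨ trans (*-congˡ (det-firstColumn-dependent v (λ j → u j ∘ suc) (λ a → N (suc a) ∘ punchIn k) (dep ∘ suc)))
           (zeroʳ _) ⟩
    0# ∎
    where
    s = (- 1#) ^ suc (toℕ k)
    e = N zero k
    M = λ j a → u j (suc a) ∷ (N (suc a) ∘ punchIn k)
    D = λ j → det (M j)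
    minor-split : ∀ j → det (minor (λ a → u j a ∷ N a) (suc k)) ≈ D j
    minor-split j = det-cong {suc m} {minor (λ a → u j a ∷ N a) (suc k)} {M j}
      λ { a zero → refl ; a (suc b) → refl }

  module InsertedColumn {n m} (u : Fin n → Vector Carrier (suc m)) (ζ : Vector (Fin n) m) where

    inserted : Fin (suc m) → Fin n → Carrier
    inserted b j = det (λ a k → u (insertAt ζ b j k) a)

    inserted-suc : ∀ b j → inserted (suc b) j ≈ - inserted (inject₁ b) j
    inserted-suc b j = trans
      (det-cong λ a k → reflexive (cong (λ i → u i a) (insertAt-suc ζ b j k)))
      (det-swapAdjacent b (λ a k → u (insertAt ζ (inject₁ b) j k) a))

    inserted-sign : ∀ j b → inserted b j ≈ (- 1#) ^ toℕ b * inserted zero j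
    inserted-sign j = <-weakInduction (λ b → inserted b j ≈ (- 1#) ^ toℕ b * inserted zero j)
      (sym (*-identityˡ _))
      (λ b ih → begin
        inserted (suc b) j                             ≈⟨ inserted-suc b j ⟩
        - inserted (inject₁ b) j                       ≈⟨ -‿cong ih ⟩
        - ((- 1#) ^ toℕ (inject₁ b) * inserted zero j) ≈⟨ sym (-1*x*y≈-xy _ _) ⟩
        (- 1#) ^ suc (toℕ (inject₁ b)) * inserted zero j
          ≡⟨ cong (λ l → (- 1#) ^ suc l * inserted zero j) (toℕ-inject₁ b) ⟩
        (- 1#) ^ suc (toℕ b) * inserted zero j ∎)

    -1^n-cancel : ∀ k {x} → (- 1#) ^ k * x ≈ 0# → x ≈ 0#
    -1^n-cancel zero    eq = trans (sym (*-identityˡ _)) eq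
    -1^n-cancel (suc k) eq = -1^n-cancel k (begin
      _       ≈⟨ sym (-‿involutive _) ⟩
      - (- _) ≈⟨ -‿cong (trans (sym (-1*x*y≈-xy _ _)) eq) ⟩
      - 0#    ≈⟨ -0#≈0# ⟩
      0#      ∎)

    inserted-duplicate : ∀ b → inserted zero (ζ b) ≈ 0#
    inserted-duplicate b = -1^n-cancel (toℕ (inject₁ b)) (trans (sym (inserted-sign (ζ b) (inject₁ b)))
      (x+x≈0⇒x≈0 (begin
        x + x ≈⟨ +-congˡ (det-cong λ a k → reflexive (cong (λ i → u i a) (≡.sym (insertAt-duplicate ζ b k)))) ⟩
        x + inserted (suc b) (ζ b) ≈⟨ +-congˡ (inserted-suc b (ζ b)) ⟩
        x + - x ≈⟨ -‿inverseʳ x ⟩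
        0# ∎)))
      where x = inserted (inject₁ b) (ζ b)

    inserted-dependent : ∀ (v : Vector Carrier n) → (∀ a → sum (λ j → v j * u j a) ≈ 0#) →
      sum (λ j → v j * inserted zero j) ≈ 0#
    inserted-dependent v dep = trans
      (sum-cong-≋ {n} λ j → *-congˡ (split j))
      (det-firstColumn-dependent v u (λ a k → u (ζ k) a) dep)
      where
      split : ∀ j → inserted zero j ≈ det (λ a → u j a ∷ (λ k → u (ζ k) a))
      split j = det-cong {suc m} {λ a k → u (insertAt ζ zero j k) a} {λ a → u j a ∷ (λ k → u (ζ k) a)}
        λ { a zero → refl ; a (suc k) → refl }

module Convexity {a ℓ₁ ℓ₂} (ℝ : RealNumbers a ℓ₁ ℓ₂) where
  open RealNumbers ℝ hiding (zero)
  open Combinatorics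
  open Geometry ℝ
  open Vector using (_∷_)
  open OrderedField ℝ
  open Determinant ℝ
  open RingProperties ring
  open SemiringSum semiring using (sum-cong-≋; ∑-comm; ∑-distrib-+; *-distribˡ-sum; *-distribʳ-sum)
  open CommutativeMonoidSolver *-commutativeMonoid using (solve; _⊕_; _⊜_)
  open SetoidReasoning setoid

  pointMass : ∀ {n} → Carrier → Fin n → Fin n → Carrier
  pointMass c i j = if does (i ≟ j) then c else 0#

  sum-pointMass : ∀ {n} c (i : Fin n) (g : Vector Carrier n) →
    sum (λ j → pointMass c i j * g j) ≈ c * g i
  sum-pointMass c zero    g = trans (+-congˡ (sum-zero λ j → zeroˡ (g (suc j)))) (+-identityʳ _)
  sum-pointMass c (suc i) g =
    trans (+-cong (zeroˡ (g zero)) (sum-pointMass c i (g ∘ suc))) (+-identityˡ _)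

  module _ {m n} (e : Fin m → Fin n) where

    pushforward : Vector Carrier m → Vector Carrier n
    pushforward w j = sum λ k → pointMass (w k) (e k) j

    sum-pushforward : ∀ w (g : Vector Carrier n) →
      sum (λ j → pushforward w j * g j) ≈ sum (λ k → w k * g (e k))
    sum-pushforward w g = begin
      sum (λ j → pushforward w j * g j)
        ≈⟨ sum-cong-≋ (λ j → *-distribʳ-sum (g j) (λ k → pointMass (w k) (e k) j)) ⟩
      sum (λ j → sum (λ k → pointMass (w k) (e k) j * g j))
        ≈⟨ ∑-comm (λ j k → pointMass (w k) (e k) j * g j) ⟩
      sum (λ k → sum (λ j → pointMass (w k) (e k) j * g j))
        ≈⟨ sum-cong-≋ (λ k → sum-pointMass (w k) (e k) g) ⟩
      sum (λ k → w k * g (e k)) ∎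

    conv-reindex : ∀ {d} {x : Vector (Point d) n} {S T p} →
      (∀ {k} → S k → T (e k)) → conv (x ∘ e) S p → conv x T p
    conv-reindex {x = x} {S} {T} S⇒T (w , 0≤w , supp , sum≈1 , comb) =
      pushforward w , (λ j → sum-nonNeg (nonNeg j)) , (λ j j∉T → sum-zero (vanish j j∉T)) ,
      sum≈1′ , λ k → trans (sum-pushforward w (λ j → x j k)) (comb k)
      where
      nonNeg : ∀ j k → 0# ≤ pointMass (w k) (e k) j
      nonNeg j k with e k ≟ j
      ... | yes _ = 0≤w k
      ... | no  _ = ≤-refl
      vanish : ∀ j → ¬ T j → ∀ k → pointMass (w k) (e k) j ≈ 0#
      vanish j j∉T k with e k ≟ j
      ... | yes ≡.refl = supp k (j∉T ∘ S⇒T)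
      ... | no  _      = refl
      sum≈1′ : sum (pushforward w) ≈ 1#
      sum≈1′ = begin
        sum (pushforward w)                 ≈⟨ sum-cong-≋ (λ j → sym (*-identityʳ (pushforward w j))) ⟩
        sum (λ j → pushforward w j * 1#)    ≈⟨ sum-pushforward w (λ _ → 1#) ⟩
        sum (λ k → w k * 1#)                ≈⟨ sum-cong-≋ (λ k → *-identityʳ (w k)) ⟩
        sum w                               ≈⟨ sum≈1 ⟩
        1#                                  ∎

  conv-empty : ∀ {d n} {x : Vector (Point d) n} {S p} → (∀ j → ¬ S j) → ¬ conv x S p
  conv-empty ∉S (w , _ , supp , sum≈1 , _) =
    1≉0 (trans (sym sum≈1) (sum-zero λ j → supp j (∉S j)))

  homogeneous-reindex : ∀ {d m n} {x : Vector (Point d) n} {e : Fin m → Fin n} →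
    Increasing e → OrderTypeHomogeneous x → OrderTypeHomogeneous (x ∘ e)
  homogeneous-reindex {e = e} inc (inj₁ pos) = inj₁ λ ι ι-inc → pos (e ∘ ι) (inc ∘ ι-inc)
  homogeneous-reindex {e = e} inc (inj₂ neg) = inj₂ λ ι ι-inc → neg (e ∘ ι) (inc ∘ ι-inc)

  alternating-tolerates : ∀ {d n} r .{{_ : NonZero r}} {x : Vector (Point d) n} →
    IsOrderedSet x → OrderTypeHomogeneous x →
    ∀ {c} → GuaranteesAlternating d r c → c ℕ.≤ n / r → Tolerates x r (n / r ℕ.∸ c)
  alternating-tolerates {n = n} r {x} ordered homog {c} guarantee c≤n/r = alternating n r , meet
    where
    meet : ∀ Y → ∣ Y ∣ ℕ.≤ n / r ℕ.∸ c → HullsMeetWithout x (alternating n r) Y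
    meet Y ∣Y∣≤
      with avoiding r (n / r) c Y (m/n*n≤m n r) (ℕ.≤-trans (ℕ.+-monoˡ-≤ c ∣Y∣≤) (ℕ.≤-reflexive (ℕ.m∸n+n≡m c≤n/r)))
    ... | e , inc , mod , e∉Y
      with guarantee (c ℕ.* r) (x ∘ e) (increasing⇒injective inc ∘ ordered)
             (homogeneous-reindex {x = x} inc homog) (ℕ.m≤m*n c r)
    ...   | p , p∈ = p , λ i → conv-reindex e (λ {k} (colour , _) → ≡.trans (same k) colour , e∉Y k) (p∈ i)
      where
      same : ∀ k → alternating n r (e k) ≡ alternating (c ℕ.* r) r k
      same k = toℕ-injective (≡.trans (toℕ-fromℕ< (m%n<n (toℕ (e k)) r))
        (≡.trans (mod k) (≡.sym (toℕ-fromℕ< (m%n<n (toℕ k) r)))))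

  sign : Parity → Carrier
  sign 0ℙ = 1#
  sign 1ℙ = - 1#

  -1^n≈sign : ∀ k → (- 1#) ^ k ≈ sign (ℕ.parity k)
  -1^n≈sign zero          = refl
  -1^n≈sign (suc zero)    = *-identityʳ _
  -1^n≈sign (suc (suc k)) = begin
    - 1# * (- 1# * (- 1#) ^ k) ≈⟨ trans (-1*x≈-x _) (-‿cong (-1*x≈-x _)) ⟩
    - - ((- 1#) ^ k)           ≈⟨ -‿involutive _ ⟩
    (- 1#) ^ k                 ≈⟨ -1^n≈sign k ⟩
    sign (ℕ.parity k)          ∎

  homogeneous⇒positive : ∀ {d n} {x : Vector (Point d) n} → OrderTypeHomogeneous x →
    ∃[ σ ] ∀ (ι : Fin (suc d) → Fin n) → Increasing ι → 0# < σ * orientation (x ∘ ι)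
  homogeneous⇒positive (inj₁ pos) = 1# , λ ι inc → <-respʳ (sym (*-identityˡ _)) (pos ι inc)
  homogeneous⇒positive (inj₂ neg) = - 1# , λ ι inc → <-respʳ (sym (-1*x≈-x _)) (neg⇒pos (neg ι inc))

  sum-difference : ∀ {n} (v w g : Vector Carrier n) →
    sum (λ j → (v j - w j) * g j) ≈ sum (λ j → v j * g j) - sum (λ j → w j * g j)
  sum-difference {n} v w g = begin
    sum (λ j → (v j - w j) * g j)
      ≈⟨ sum-cong-≋ {n} (λ j → trans (distribʳ (g j) (v j) (- w j)) (+-congˡ (sym (-‿distribˡ-* _ _)))) ⟩
    sum (λ j → v j * g j + - (w j * g j))
      ≈⟨ ∑-distrib-+ (λ j → v j * g j) (λ j → - (w j * g j)) ⟩
    sum (λ j → v j * g j) + sum (λ j → - (w j * g j))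
      ≈⟨ +-congˡ (sum-neg (λ j → w j * g j)) ⟩
    sum (λ j → v j * g j) - sum (λ j → w j * g j) ∎

  lifted : ∀ {d n} → Vector (Point d) n → Fin n → Vector Carrier (suc d)
  lifted x j = 1# ∷ x j

  module _ {d n} {x : Vector (Point d) n} (homog : OrderTypeHomogeneous x)
    {v w : Vector Carrier n} (0≤v : ∀ j → 0# ≤ v j)
    (dep : ∀ a → sum (λ j → (v j - w j) * lifted x j a) ≈ 0#) where

    -- The affine functional vanishing on the points of Z is positive, up to a
    -- common sign, at every other point that carries weight.
    supported : ∀ Z → ∣ Z ∣ ≡ d → (∀ {j} → j Subset.∉ Z → w j ≈ 0#) →
      ∀ p → (∀ {j} → j Subset.∉ Z → ℕ.parity (toℕ (rank Z j)) ≡ p ⊎ v j ≈ 0#) →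
      ∀ {j} → j Subset.∉ Z → v j ≈ 0#
    supported Z ≡.refl w≈0 p same {j} j∉Z with same j∉Z
    ... | inj₂ v≈0 = v≈0
    ... | inj₁ par = x*y≈0⇒x≈0 (0≤v j) (positive j j∉Z par) (sum≈0⇒≈0 nonNeg sum≈0 j)
      where
      open InsertedColumn (lifted x) (elements Z)
      f = inserted zero
      σ = proj₁ (homogeneous⇒positive {x = x} homog)
      τ = σ * sign p

      f-vanishes : ∀ {j} → j Subset.∈ Z → f j ≈ 0#
      f-vanishes j∈Z with elements-surjective Z j∈Z
      ... | b , ≡.refl = inserted-duplicate b

      positive : ∀ j → j Subset.∉ Z → ℕ.parity (toℕ (rank Z j)) ≡ p → 0# < τ * f j
      positive j j∉Z ≡.refl = <-respʳ
        (begin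
          σ * inserted (rank Z j) j
            ≈⟨ *-congˡ (inserted-sign j (rank Z j)) ⟩
          σ * ((- 1#) ^ toℕ (rank Z j) * f j)
            ≈⟨ *-congˡ (*-congʳ (-1^n≈sign (toℕ (rank Z j)))) ⟩
          σ * (sign p * f j)
            ≈⟨ sym (*-assoc _ _ _) ⟩
          τ * f j ∎)
        (proj₂ (homogeneous⇒positive {x = x} homog) _ (insert-increasing Z j j∉Z))

      nonNeg : ∀ j → 0# ≤ v j * (τ * f j)
      nonNeg j with j ∈? Z
      ... | yes j∈Z = ≤-resp (sym (trans (*-congˡ (trans (*-congˡ (f-vanishes j∈Z)) (zeroʳ _))) (zeroʳ _))) ≤-refl
      ... | no  j∉Z with same j∉Z
      ...   | inj₁ par = *-nonNeg-pos (0≤v j) (positive j j∉Z par)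
      ...   | inj₂ v≈0 = ≤-resp (sym (trans (*-congʳ v≈0) (zeroˡ _))) ≤-refl

      w*f≈0 : ∀ j → w j * f j ≈ 0#
      w*f≈0 j with j ∈? Z
      ... | yes j∈Z = trans (*-congˡ (f-vanishes j∈Z)) (zeroʳ _)
      ... | no  j∉Z = trans (*-congʳ (w≈0 j∉Z)) (zeroˡ _)

      sum-v*f≈0 : sum (λ j → v j * f j) ≈ 0#
      sum-v*f≈0 = begin
        sum (λ j → v j * f j)
          ≈⟨ sym (trans (+-congˡ -0#≈0#) (+-identityʳ _)) ⟩
        sum (λ j → v j * f j) - 0#
          ≈⟨ +-congˡ (-‿cong (sym (sum-zero w*f≈0))) ⟩
        sum (λ j → v j * f j) - sum (λ j → w j * f j)
          ≈⟨ sym (sum-difference v w f) ⟩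
        sum (λ j → (v j - w j) * f j)
          ≈⟨ inserted-dependent (λ j → v j - w j) dep ⟩
        0# ∎

      sum≈0 : sum (λ j → v j * (τ * f j)) ≈ 0#
      sum≈0 = begin
        sum (λ j → v j * (τ * f j))
          ≈⟨ sum-cong-≋ (λ j → solve 3 (λ v t f → v ⊕ (t ⊕ f) ⊜ t ⊕ (v ⊕ f)) refl (v j) τ (f j)) ⟩
        sum (λ j → τ * (v j * f j))
          ≈⟨ sym (*-distribˡ-sum τ (λ j → v j * f j)) ⟩
        τ * sum (λ j → v j * f j)
          ≈⟨ trans (*-congˡ sum-v*f≈0) (zeroʳ τ) ⟩
        0# ∎

  neighbourly : ∀ {d n} {x : Vector (Point d) n} → OrderTypeHomogeneous x → d ℕ.< n →
    ∀ {S} → 2 ℕ.* ∣ S ∣ ℕ.≤ d → ∀ {P Q q} →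
    (∀ {j} → P j → j Subset.∈ S) → (∀ {j} → Q j → j Subset.∉ S) →
    conv x P q → ¬ conv x Q q
  neighbourly {d} {n} {x} homog d<n {S} 2∣S∣≤d P⊆S Q∩S=∅
    (w , _ , w-supp , w-sum , w-comb) (v , 0≤v , v-supp , v-sum , v-comb)
    with galeCover-exact S 2∣S∣≤d (ℕ.<⇒≤ d<n)
  ... | Z , S⊆Z , ∣Z∣≡d , p , gale = 1≉0 (trans (sym v-sum) (sum-zero v≈0))
    where
    balanced : ∀ {g : Vector Carrier n} {s} → sum (λ j → v j * g j) ≈ s → sum (λ j → w j * g j) ≈ s →
      sum (λ j → (v j - w j) * g j) ≈ 0#
    balanced {g} {s} eq₁ eq₂ = trans (sum-difference v w g)
      (trans (+-cong eq₁ (-‿cong eq₂)) (-‿inverseʳ s))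

    dep : ∀ a → sum (λ j → (v j - w j) * lifted x j a) ≈ 0#
    dep zero    = balanced {λ _ → 1#} (trans (sum-cong-≋ λ j → *-identityʳ (v j)) v-sum)
                                      (trans (sum-cong-≋ λ j → *-identityʳ (w j)) w-sum)
    dep (suc k) = balanced {λ j → x j k} (v-comb k) (w-comb k)

    w≈0 : ∀ {j} → j Subset.∉ S → w j ≈ 0#
    w≈0 j∉S = w-supp _ (j∉S ∘ P⊆S)

    v≈0-outside : ∀ {j} → j Subset.∉ Z → v j ≈ 0#
    v≈0-outside = supported {x = x} homog 0≤v dep Z ∣Z∣≡d (λ j∉Z → w≈0 (j∉Z ∘ S⊆Z)) p (inj₁ ∘ gale _)

    v≈0 : ∀ j → v j ≈ 0#
    v≈0 i with i ∈? S | i ∈? Z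
    ... | yes i∈S | _       = v-supp i (λ i∈Q → Q∩S=∅ i∈Q i∈S)
    ... | no  _   | no  i∉Z = v≈0-outside i∉Z
    ... | no  i∉S | yes i∈Z with exchange i∈Z (≡.subst (ℕ._< n) (≡.sym ∣Z∣≡d) d<n)
    ...   | Z′ , ∣Z′∣≡∣Z∣ , i∉Z′ , keep =
      supported {x = x} homog 0≤v dep Z′ (≡.trans ∣Z′∣≡∣Z∣ ∣Z∣≡d)
        (λ j∉Z′ → w≈0 λ j∈S → j∉Z′ (keep (S⊆Z j∈S) λ { ≡.refl → i∉S j∈S }))
        (ℕ.parity (toℕ (rank Z′ i))) only-i i∉Z′
      where
      only-i : ∀ {j} → j Subset.∉ Z′ → ℕ.parity (toℕ (rank Z′ j)) ≡ ℕ.parity (toℕ (rank Z′ i)) ⊎ v j ≈ 0#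
      only-i {j} j∉Z′ with j ≟ i
      ... | yes ≡.refl = inj₁ ≡.refl
      ... | no  j≢i    = inj₂ (v≈0-outside λ j∈Z → j∉Z′ (keep j∈Z j≢i))

  tolerates⇒t+⌊d/2⌋≤n/r : ∀ {d n} r .{{_ : NonZero r}} {x : Vector (Point d) n} {t} →
    OrderTypeHomogeneous x → d ℕ.≤ 3 ⊎ (2 ℕ.≤ r × d ℕ.< n) →
    Tolerates x r t → t ℕ.+ ⌊ d /2⌋ ℕ.≤ n / r
  tolerates⇒t+⌊d/2⌋≤n/r {d} {n} r {x} {t} homog cases (A , meet) =
    decidable-stable (t ℕ.+ ⌊ d /2⌋ ℕ.≤? n / r) λ ≰ → impossible (ℕ.≰⇒> ≰)
    where
    other : 2 ℕ.≤ r → ∀ (i : Fin r) → ∃[ i′ ] i′ ≢ i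
    other (ℕ.s≤s (ℕ.s≤s _)) zero    = suc zero , λ ()
    other (ℕ.s≤s (ℕ.s≤s _)) (suc i) = zero , λ ()

    2*⌊d/2⌋≤d : 2 ℕ.* ⌊ d /2⌋ ℕ.≤ d
    2*⌊d/2⌋≤d = ℕ.≤-trans
      (ℕ.+-monoʳ-≤ ⌊ d /2⌋ (ℕ.≤-trans (ℕ.≤-reflexive (ℕ.+-identityʳ _)) (ℕ.⌊n/2⌋≤⌈n/2⌉ d)))
      (ℕ.≤-reflexive (ℕ.⌊n/2⌋+⌈n/2⌉≡n d))

    impossible : ¬ n / r ℕ.< t ℕ.+ ⌊ d /2⌋
    impossible n/r<t+d/2
      with i , ∣Aᵢ∣≤n/r ← smallFibre A
      with Y , S , ∣Y∣≤t , ∣S∣≤ , S⊆Aᵢ , rest ← deleteUpTo (fibre A i) t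
      with q , q∈ ← meet Y ∣Y∣≤t
      = refute cases
      where
      ∣S∣≤n/r∸t : ∣ S ∣ ℕ.≤ n / r ℕ.∸ t
      ∣S∣≤n/r∸t = ℕ.≤-trans ∣S∣≤ (ℕ.∸-monoˡ-≤ t ∣Aᵢ∣≤n/r)

      part⊆S : ∀ {j} → part∖ A Y i j → j Subset.∈ S
      part⊆S {j} (eq , j∉Y) = rest (∈-fibre⁺ A j eq) j∉Y

      refute : ¬ (d ℕ.≤ 3 ⊎ (2 ℕ.≤ r × d ℕ.< n))
      refute (inj₁ d≤3) = conv-empty {x = x} (λ j j∈ → ∉S (part⊆S j∈)) (q∈ i)
        where
        n/r≤t : n / r ℕ.≤ t
        n/r≤t = ℕ.s≤s⁻¹ (ℕ.≤-trans n/r<t+d/2 (ℕ.≤-trans (ℕ.+-monoʳ-≤ t (ℕ.⌊n/2⌋-mono d≤3))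
          (ℕ.≤-reflexive (ℕ.+-comm t 1))))
        ∣S∣≤0 : ∣ S ∣ ℕ.≤ 0
        ∣S∣≤0 = ℕ.≤-trans ∣S∣≤n/r∸t (ℕ.≤-reflexive (ℕ.m≤n⇒m∸n≡0 n/r≤t))
        ∉S : ∀ {j} → j Subset.∉ S
        ∉S j∈S with elements-surjective S j∈S
        ... | b , _ with () ← ≡.subst Fin (ℕ.n≤0⇒n≡0 ∣S∣≤0) b
      refute (inj₂ (2≤r , d<n)) with i′ , i′≢i ← other 2≤r i =
        neighbourly {x = x} homog d<n 2∣S∣≤d part⊆S
          (λ {j} (eq , _) j∈S → i′≢i (≡.trans (≡.sym eq) (∈-fibre⁻ A j (S⊆Aᵢ j∈S))))
          (q∈ i) (q∈ i′)
        where
        ∣S∣≤⌊d/2⌋ : ∣ S ∣ ℕ.≤ ⌊ d /2⌋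
        ∣S∣≤⌊d/2⌋ = ℕ.≤-trans ∣S∣≤n/r∸t (ℕ.m≤n+o⇒m∸n≤o (n / r) t (ℕ.<⇒≤ n/r<t+d/2))
        2∣S∣≤d : 2 ℕ.* ∣ S ∣ ℕ.≤ d
        2∣S∣≤d = ℕ.≤-trans (ℕ.*-monoʳ-≤ 2 ∣S∣≤⌊d/2⌋) 2*⌊d/2⌋≤d

open import Data.Nat.Base using (ℕ; NonZero; _≤_; _<_; _/_; ⌊_/2⌋)
open import Data.Integer.Base as ℤ using (+_; _-_)

m≤n+k⇒m-k≤n : ∀ {m n k} → m ℕ.≤ n ℕ.+ k → + m ℤ.- + k ℤ.≤ + n
m≤n+k⇒m-k≤n {m} {n} {k} m≤n+k = begin
  + m ℤ.- + k           ≤⟨ ℤ.+-monoˡ-≤ (ℤ.- + k) (ℤ.+≤+ m≤n+k) ⟩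
  + (n ℕ.+ k) ℤ.- + k   ≡⟨ ℤ.m-n≡m⊖n (n ℕ.+ k) k ⟩
  (n ℕ.+ k) ⊖ k         ≡⟨ ℤ.≤-⊖ (ℕ.m≤n+m k n) ⟩
  + (n ℕ.+ k ℕ.∸ k)     ≡⟨ cong +_ (ℕ.m+n∸n≡m n k) ⟩
  + n                   ∎
  where open ℤ.≤-Reasoning

m+k≤n⇒m≤n-k : ∀ {m n k} → m ℕ.+ k ℕ.≤ n → + m ℤ.≤ + n ℤ.- + k
m+k≤n⇒m≤n-k {m} {n} {k} m+k≤n = begin
  + m                   ≡⟨ cong +_ (≡.sym (ℕ.m+n∸n≡m m k)) ⟩
  + (m ℕ.+ k ℕ.∸ k)     ≤⟨ ℤ.+≤+ (ℕ.∸-monoˡ-≤ k m+k≤n) ⟩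
  + (n ℕ.∸ k)           ≡⟨ ≡.sym (ℤ.≤-⊖ (ℕ.≤-trans (ℕ.m≤n+m k m) m+k≤n)) ⟩
  n ⊖ k                 ≡⟨ ≡.sym (ℤ.m-n≡m⊖n n k) ⟩
  + n ℤ.- + k           ∎
  where open ℤ.≤-Reasoning

theorem3p4 : ∀ {a ℓ₁ ℓ₂} (ℝ : RealNumbers a ℓ₁ ℓ₂) → let open Geometry ℝ in
    ∀ (d r n : ℕ) .{{_ : NonZero r}} (x : Vector (Point d) n) →
    IsOrderedSet x → OrderTypeHomogeneous x →
    ∀ (c : ℕ) → GuaranteesAlternating d r c →
    ∀ (t : ℕ) → IsTolerance x r t →
    (+ (n / r) - + c ℤ.≤ + t)
    × ((d ≤ 3) ⊎ ((2 ≤ r) × (d < n)) → + t ℤ.≤ + (n / r) - + ⌊ d /2⌋)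
theorem3p4 ℝ d r n x ordered homog c guarantee t (tolerates , maximal) =
  m≤n+k⇒m-k≤n lower , λ cases → m+k≤n⇒m≤n-k (tolerates⇒t+⌊d/2⌋≤n/r r {x} homog cases tolerates)
  where
  open Convexity ℝ
  lower : n / r ≤ t ℕ.+ c
  lower with ℕ.≤-total c (n / r)
  ... | inj₁ c≤n/r = ≡.subst (_≤ t ℕ.+ c) (ℕ.m∸n+n≡m c≤n/r)
    (ℕ.+-monoˡ-≤ c (maximal _ (alternating-tolerates r {x} ordered homog guarantee c≤n/r)))
  ... | inj₂ n/r≤c = ℕ.≤-trans n/r≤c (ℕ.m≤n+m c t)
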